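{- Consider an instance on proper intervals, with jobs indexed so that $i<j$ implies $r_i\le r_j$ and $d_i\le d_j$. Every feasible schedule can be transformed, without activating additional time slots and without changing the set of completed jobs, into a feasible schedule with no inversion pairs. Consequently, every proper-interval instance has an optimal schedule with no inversion pairs.
   Context: Weighted-throughput active-time scheduling: jobs $J=\{1,\dots,n\}$, where job $j$ has an integer release time $r_j$, integer deadline $d_j$, positive integer processing time $p_j$ and nonnegative weight $w_j$; a positive integer capacity $m$ and an integer active-time budget $K$. The window of $j$ is the set of integer slots $W_j=\{r_j,\dots,d_j\}$. A feasible schedule assigns to each integer slot $t$ a set $A(t)\subseteq J$ with $|A(t)|\le m$ of jobs processed (one unit each) in slot $t$, where $j\in A(t)$ implies $t\in W_j$, and at most $K$ slots are active (a slot $t$ is active if $A(t)\ne\emptyset$). A job is completed if it receives $p_j$ units; it is assumed that a schedule processes a job if and only if it completes it (so a processed job appears in exactly $p_j$ of the sets $A(t)$), and jobs with $p_j>K$ are discarded. An optimal schedule maximizes the total weight of completed jobs. The instance is on proper intervals if no window strictly contains another; then jobs sorted by nondecreasing release time (ties broken arbitrarily) are also sorted by deadline. Inversion pair: for jobs $i<j$, the pair $(i,j)$ is an inversion pair of the schedule if there are slots $t<t'$ such that $j\in A(t)$, $i\notin A(t)$, $i\in A(t')$ and $j\notin A(t')$.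
   Formalization: The nonnegative job weights are taken to be rational numbers instead of arbitrary nonnegative real numbers. -}

module Defs where

open import Algebra.Properties.CommutativeMonoid.Sum using (sum)
open import Data.Fin.Base using (Fin; _<_)
open import Data.Fin.Subset using (Subset; _∈_; _∉_; ∣_∣; Nonempty)
open import Data.Fin.Subset.Properties using (_∈?_)
open import Data.Integer.Base as ℤ using (ℤ)
open import Data.List.Base using (List; length)
open import Data.List.Membership.Propositional using (find; lose) renaming (_∈_ to _∈ˡ_)
open import Data.List.Relation.Unary.Any using (any?)
open import Data.List.Relation.Unary.Unique.Propositional using (Unique)
open import Data.Nat.Base as ℕ using (ℕ)
open import Data.Product.Base using (∃; ∃₂; _×_; _,_)
open import Data.Rational.Base as ℚ using (ℚ; 0ℚ)
open import Data.Rational.Properties using (+-0-commutativeMonoid)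
open import Data.Bool.Base using (if_then_else_)
open import Function.Bundles using (_⇔_; module Equivalence)
open import Level using (0ℓ)
open import Relation.Binary.PropositionalEquality.Core using (_≡_)
open import Relation.Nullary using (Dec; does; ¬_)
open import Relation.Nullary.Decidable using (map′)
open import Relation.Unary using (Pred; _⊂_)

-- The set P has exactly k elements: it is enumerated, without repetition,
-- by a list of length k.
HasSize : Pred ℤ 0ℓ → ℕ → Set
HasSize P k = ∃ λ ts → Unique ts × length ts ≡ k × (∀ t → P t ⇔ t ∈ˡ ts)

-- Jobs are numbered from 0.  The field p≤K records that jobs which cannot
-- be completed within the budget have been discarded.
record Instance : Set where
  field
    n   : ℕ
    r d : Fin n → ℤ
    p   : Fin n → ℕ
    w   : Fin n → ℚ
    m K : ℕ
    p>0 : ∀ j → 0 ℕ.< p j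
    w≥0 : ∀ j → 0ℚ ℚ.≤ w j
    m>0 : 0 ℕ.< m
    p≤K : ∀ j → p j ℕ.≤ K

  Window : Fin n → Pred ℤ 0ℓ
  Window j t = r j ℤ.≤ t × t ℤ.≤ d j

module _ (I : Instance) where
  open Instance I

  ProperIntervals : Set
  ProperIntervals = ∀ i j → ¬ (Window i ⊂ Window j)

  SortedIndices : Set
  SortedIndices = ∀ i j → i < j → r i ℤ.≤ r j × d i ℤ.≤ d j

  Schedule : Set
  Schedule = ℤ → Subset n

  Active : Schedule → Pred ℤ 0ℓ
  Active A t = Nonempty (A t)

  Processed : Schedule → Pred (Fin n) 0ℓ
  Processed A j = ∃ λ t → j ∈ A t

  Completed : Schedule → Pred (Fin n) 0ℓ
  Completed A j = HasSize (λ t → j ∈ A t) (p j)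

  record IsFeasible (A : Schedule) : Set where
    field
      capacity            : ∀ t → ∣ A t ∣ ℕ.≤ m
      within-window       : ∀ j t → j ∈ A t → Window j t
      budget              : ∃ λ k → k ℕ.≤ K × HasSize (Active A) k
      processed⇔completed : ∀ j → Processed A j ⇔ Completed A j

  InversionPair : Schedule → Fin n → Fin n → Set
  InversionPair A i j = i < j × ∃₂ λ t t′ → t ℤ.< t′ ×
    j ∈ A t × i ∉ A t × i ∈ A t′ × j ∉ A t′

  NoInversionPairs : Schedule → Set
  NoInversionPairs A = ∀ i j → ¬ InversionPair A i j

  completed? : ∀ {A} → IsFeasible A → ∀ j → Dec (Completed A j)
  completed? {A} feasible j with IsFeasible.budget feasible
  ... | _ , _ , ts , _ , _ , active⇔∈ts =
    map′
      (λ any → let t , _ , j∈At = find any in to (p⇔c j) (t , j∈At))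
      (λ c → let t , j∈At = from (p⇔c j) c in
             lose (to (active⇔∈ts t) (j , j∈At)) j∈At)
      (any? (λ t → j ∈? A t) ts)
    where
    open Equivalence
    p⇔c = IsFeasible.processed⇔completed feasible

  completedWeight : ∀ {A} → IsFeasible A → ℚ
  completedWeight feasible =
    sum +-0-commutativeMonoid
      (λ j → if does (completed? feasible j) then w j else 0ℚ)

  IsOptimal : ∀ {A} → IsFeasible A → Set
  IsOptimal feasible =
    ∀ {B} (feasibleB : IsFeasible B) →
      completedWeight feasibleB ℚ.≤ completedWeight feasible

-- Exchanging the two units of an inversion pair (i, j) at slots t < t′ keeps
-- the set of active slots, the load of every slot and the set of completed
-- jobs, and sortedness keeps both jobs in their windows.  The exchange moves
-- job i to an earlier slot and leaves every job smaller than i untouched, so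
-- the vector of total offsets ∑ (s − r x), one entry per job x, decreases
-- lexicographically and repeated exchanges terminate.  An optimal schedule
-- exists because schedules live on the finitely many slots of the windows.
module Submission where

open import Defs
open import Data.Bool.Base using (if_then_else_; _∨_)
open import Data.Fin.Base as Fin using (Fin; zero; suc)
import Data.Fin.Properties as Fin
open import Data.Fin.Subset
  using (Subset; inside; outside; _∈_; _∉_; ∣_∣; ⊥; ⁅_⁆; _∪_; _-_; Nonempty)
open import Data.Fin.Subset.Properties
  using (_∈?_; nonempty?; ∉⊥; ∣⊥∣≡0; p⊆q⇒∣p∣≤∣q∣; x∈p∪q⁺; x∈⁅x⁆; ∣⁅x⁆∣≡1;
         x∈p⇒∣p-x∣<∣p∣; x∈p∧x≢y⇒x∈p-y; Empty-unique)
open import Data.Integer.Base as ℤ using (ℤ)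
import Data.Integer.Properties as ℤ
open import Data.List.Base
  using (List; []; _∷_; length; filter; map; upTo; allFin; concatMap; deduplicate;
         cartesianProductWith)
open import Data.List.Membership.Propositional
  using (find; lose) renaming (_∈_ to _∈ˡ_)
open import Data.List.Membership.Propositional.Properties
  using (∈-map⁺; ∈-map⁻; ∈-filter⁺; ∈-filter⁻; ∈-upTo⁺; ∈-allFin; ∈-concatMap⁺;
         ∈-deduplicate⁺; ∈-cartesianProductWith⁺)
open import Data.List.Membership.Propositional.Properties.WithK using (unique∧set⇒bag)
open import Data.List.Properties using (length-map; map-∘; filter-≐)
open import Data.List.Relation.Binary.BagAndSetEquality using (∼bag⇒↭)
open import Data.List.Relation.Binary.Permutation.Propositional using (_↭_)
import Data.List.Relation.Binary.Permutation.Propositional.Properties as ↭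
open import Data.List.Relation.Unary.All as All using (All; []; _∷_)
open import Data.List.Relation.Unary.Any using (any?; here; there)
open import Data.List.Relation.Unary.Unique.DecPropositional.Properties using (deduplicate-!)
open import Data.List.Relation.Unary.Unique.Propositional using (Unique; []; _∷_)
import Data.List.Relation.Unary.Unique.Propositional.Properties as Unique
open import Data.Nat.Base as ℕ using (ℕ; z≤n; s≤s)
import Data.Nat.Properties as ℕ
open import Data.Nat.Induction using (<-wellFounded)
open import Data.Nat.ListAction using (sum)
open import Data.Nat.ListAction.Properties using (sum-↭)
open import Data.Product.Base using (Σ; ∃; ∃₂; _×_; _,_; proj₁; proj₂)
import Data.Rational.Properties as ℚ
open import Data.Sum.Base using (_⊎_; inj₁; inj₂)
open import Data.Vec.Base using (Vec; []; _∷_; lookup; tabulate)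
open import Data.Vec.Properties using (lookup∘tabulate; lookup⇒[]=; []=⇒lookup)
open import Data.Vec.Relation.Binary.Lex.Strict as Lex using (Lex-<; this; next)
open import Function.Base using (_∘_; id)
open import Function.Bundles using (_⇔_; mk⇔; module Equivalence)
import Function.Properties.Equivalence as ⇔
open import Induction.WellFounded using (Acc; acc; WellFounded)
open import Level using (0ℓ)
open import Relation.Binary.PropositionalEquality
  using (_≡_; _≢_; _≗_; refl; sym; trans; cong; subst; resp₂)
open import Relation.Nullary using (Dec; yes; no; does; ¬?; contradiction)
open import Relation.Nullary.Decidable
  using (map′; _×-dec_; _→-dec_; does-⇔; decidable-stable; dec-true; dec-false)
open import Relation.Unary using (Pred; _⊆_; Decidable)
open import Relation.Binary.Bundles using (DecTotalOrder)
open import Data.List.Extrema (DecTotalOrder.totalOrder ℚ.≤-decTotalOrder)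
  using (argmax; f[xs]≤f[argmax])
open import Algebra.Properties.CommutativeMonoid.Sum ℚ.+-0-commutativeMonoid
  using (sum-cong-≗)

open Equivalence using (to; from)

-- Enumerated sets of slots and their sizes.

Enumerates : List ℤ → Pred ℤ 0ℓ → Set
Enumerates ts P = Unique ts × (∀ t → P t ⇔ t ∈ˡ ts)

module _ {P : Pred ℤ 0ℓ} where

  hasSize : ∀ {ts} → Enumerates ts P → HasSize P (length ts)
  hasSize {ts} (uniq , P⇔) = ts , uniq , refl , P⇔

  enumerates-cong : ∀ {Q ts} → (∀ t → P t ⇔ Q t) → Enumerates ts P → Enumerates ts Q
  enumerates-cong P⇔Q (uniq , P⇔) = uniq , λ t → ⇔.trans (⇔.sym (P⇔Q t)) (P⇔ t)

  enumerates-filter : ∀ {ts} (P? : Decidable P) → Unique ts → (∀ {t} → P t → t ∈ˡ ts) →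
                      Enumerates (filter P? ts) P
  enumerates-filter {ts} P? uniq P⊆ts = Unique.filter⁺ P? uniq ,
    λ t → mk⇔ (λ pt → ∈-filter⁺ P? (P⊆ts pt) pt) (proj₂ ∘ ∈-filter⁻ P? {xs = ts})

  -- An involution is its own inverse, so the preimage of `P` is the image of `ts`, and injectivity
  -- keeps that image free of repetitions.
  enumerates-∘ : ∀ {f : ℤ → ℤ} {ts} → (∀ t → f (f t) ≡ t) → Enumerates ts P →
                 Enumerates (map f ts) (P ∘ f)
  enumerates-∘ {f} {ts} invol (uniq , P⇔) = Unique.map⁺ injective uniq , λ t → mk⇔
    (λ pft → subst (_∈ˡ map f ts) (invol t) (∈-map⁺ f (to (P⇔ (f t)) pft)))
    (λ t∈ → let s , s∈ts , t≡fs = ∈-map⁻ f t∈ in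
            from (P⇔ (f t)) (subst (_∈ˡ ts) (trans (sym (invol s)) (cong f (sym t≡fs))) s∈ts))
    where
    injective : ∀ {s t} → f s ≡ f t → s ≡ t
    injective {s} {t} eq = trans (sym (invol s)) (trans (cong f eq) (invol t))

  -- Lists without repetitions that have the same members agree as bags. This makes sizes unique and
  -- lets sums over a set ignore the order of enumeration.
  enumerates-↭ : ∀ {ts us} → Enumerates ts P → Enumerates us P → ts ↭ us
  enumerates-↭ (uniq , P⇔) (uniq′ , P⇔′) =
    ∼bag⇒↭ (unique∧set⇒bag uniq uniq′ (λ {t} → ⇔.trans (⇔.sym (P⇔ t)) (P⇔′ t)))

  hasSize-unique : ∀ {k l} → HasSize P k → HasSize P l → k ≡ l
  hasSize-unique (_ , uniq , refl , P⇔) (_ , uniq′ , refl , P⇔′) =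
    ↭.↭-length (enumerates-↭ (uniq , P⇔) (uniq′ , P⇔′))

  hasSize-cong : ∀ {Q k} → (∀ t → P t ⇔ Q t) → HasSize P k → HasSize Q k
  hasSize-cong P⇔Q (ts , uniq , len , P⇔) =
    ts , uniq , len , proj₂ (enumerates-cong {ts = ts} P⇔Q (uniq , P⇔))

  hasSize-∘ : ∀ {f : ℤ → ℤ} {k} → (∀ t → f (f t) ≡ t) → HasSize P k → HasSize (P ∘ f) k
  hasSize-∘ {f} invol (ts , uniq , refl , P⇔) with enumerates-∘ invol (uniq , P⇔)
  ... | uniq′ , P⇔′ = map f ts , uniq′ , length-map f ts , P⇔′

  -- Search over the infinitely many slots becomes finite once every witness is known to lie in
  -- `ts`.
  ∃? : ∀ {ts} → Decidable P → (∀ {t} → P t → t ∈ˡ ts) → Dec (∃ P)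
  ∃? {ts} P? P⊆ts = map′
    (λ any → let t , _ , pt = find any in t , pt)
    (λ (t , pt) → lose (P⊆ts pt) pt)
    (any? P? ts)

  -- Filtering `ts` produces one enumeration of `P`, and by uniqueness its length is the only size
  -- that can be right.
  hasSize? : ∀ {ts} → Decidable P → Unique ts → (∀ {t} → P t → t ∈ˡ ts) →
             ∀ k → Dec (HasSize P k)
  hasSize? P? uniq P⊆ts k = map′
    (λ len → subst (HasSize P) len (hasSize (enumerates-filter P? uniq P⊆ts)))
    (hasSize-unique (hasSize (enumerates-filter P? uniq P⊆ts)))
    (_ ℕ.≟ k)

hasSize-∘⁻ : ∀ {P : Pred ℤ 0ℓ} {f : ℤ → ℤ} {k} → (∀ t → f (f t) ≡ t) →
             HasSize (P ∘ f) k → HasSize P k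
hasSize-∘⁻ {P} {f} invol =
  hasSize-cong (λ t → mk⇔ (subst P (invol t)) (subst P (sym (invol t)))) ∘ hasSize-∘ invol

-- Transposition of two slots.

transpose : ℤ → ℤ → ℤ → ℤ
transpose a b s = if does (s ℤ.≟ a) then b else if does (s ℤ.≟ b) then a else s

module _ (a b : ℤ) where

  transpose-left : transpose a b a ≡ b
  transpose-left rewrite dec-true (a ℤ.≟ a) refl = refl

  transpose-right : transpose a b b ≡ a
  transpose-right with b ℤ.≟ a
  -- If the two slots coincide, the first test succeeds and returns `b`, which is then `a`.
  ... | yes b≡a = b≡a
  ... | no  _ rewrite dec-true (b ℤ.≟ b) refl = refl

  transpose-other : ∀ {s} → s ≢ a → s ≢ b → transpose a b s ≡ s
  transpose-other {s} s≢a s≢b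
    rewrite dec-false (s ℤ.≟ a) s≢a | dec-false (s ℤ.≟ b) s≢b = refl

  transpose-involutive : ∀ s → transpose a b (transpose a b s) ≡ s
  transpose-involutive s = helper (s ℤ.≟ a) (s ℤ.≟ b)
    where
    helper : Dec (s ≡ a) → Dec (s ≡ b) → transpose a b (transpose a b s) ≡ s
    helper (yes refl) _          = trans (cong (transpose a b) transpose-left) transpose-right
    helper (no _)     (yes refl) = trans (cong (transpose a b) transpose-right) transpose-left
    helper (no s≢a)   (no s≢b)   =
      trans (cong (transpose a b) (transpose-other s≢a s≢b)) (transpose-other s≢a s≢b)

-- Monotonicity of offsets and of their sums.

∣offset∣ : ∀ {a s} → a ℤ.≤ s → ℤ.+ ℤ.∣ s ℤ.- a ∣ ≡ s ℤ.- a
∣offset∣ a≤s = ℤ.0≤i⇒+∣i∣≡i (ℤ.i≤j⇒0≤j-i a≤s)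

-- From `a` onwards the absolute value is the signed difference, so monotonicity over the integers
-- carries over to the naturals in which the measure takes its values.
∣offset∣-mono-≤ : ∀ {a s t} → a ℤ.≤ s → s ℤ.≤ t → ℤ.∣ s ℤ.- a ∣ ℕ.≤ ℤ.∣ t ℤ.- a ∣
∣offset∣-mono-≤ {a} {s} {t} a≤s s≤t = ℤ.drop‿+≤+ (begin
  ℤ.+ ℤ.∣ s ℤ.- a ∣  ≡⟨ ∣offset∣ a≤s ⟩
  s ℤ.- a            ≤⟨ ℤ.+-monoˡ-≤ (ℤ.- a) s≤t ⟩
  t ℤ.- a            ≡⟨ ∣offset∣ (ℤ.≤-trans a≤s s≤t) ⟨
  ℤ.+ ℤ.∣ t ℤ.- a ∣  ∎)
  where open ℤ.≤-Reasoning

∣offset∣-mono-< : ∀ {a s t} → a ℤ.≤ s → s ℤ.< t → ℤ.∣ s ℤ.- a ∣ ℕ.< ℤ.∣ t ℤ.- a ∣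
∣offset∣-mono-< {a} {s} {t} a≤s s<t = ℤ.drop‿+<+ (begin-strict
  ℤ.+ ℤ.∣ s ℤ.- a ∣  ≡⟨ ∣offset∣ a≤s ⟩
  s ℤ.- a            <⟨ ℤ.+-monoˡ-< (ℤ.- a) s<t ⟩
  t ℤ.- a            ≡⟨ ∣offset∣ (ℤ.≤-trans a≤s (ℤ.<⇒≤ s<t)) ⟨
  ℤ.+ ℤ.∣ t ℤ.- a ∣  ∎)
  where open ℤ.≤-Reasoning

module _ {A : Set} {f g : A → ℕ} where

  sum-mono-≤ : ∀ xs → (∀ {x} → x ∈ˡ xs → f x ℕ.≤ g x) → sum (map f xs) ℕ.≤ sum (map g xs)
  sum-mono-≤ []       f≤g = z≤n
  sum-mono-≤ (x ∷ xs) f≤g = ℕ.+-mono-≤ (f≤g (here refl)) (sum-mono-≤ xs (f≤g ∘ there))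

  sum-mono-< : ∀ {xs y} → (∀ {x} → x ∈ˡ xs → f x ℕ.≤ g x) → y ∈ˡ xs → f y ℕ.< g y →
               sum (map f xs) ℕ.< sum (map g xs)
  sum-mono-< f≤g (here refl) fy<gy = ℕ.+-mono-<-≤ fy<gy (sum-mono-≤ _ (f≤g ∘ there))
  sum-mono-< f≤g (there y∈)  fy<gy =
    ℕ.+-mono-≤-< (f≤g (here refl)) (sum-mono-< (f≤g ∘ there) y∈ fy<gy)

-- Lexicographic order on vectors of naturals.

_<ₗₑₓ_ : ∀ {n} → Vec ℕ n → Vec ℕ n → Set
_<ₗₑₓ_ = Lex-< _≡_ ℕ._<_

-- The common length `n` matters: over lists of unbounded length the order has infinite descents.
<ₗₑₓ-wellFounded : ∀ {n} → WellFounded (_<ₗₑₓ_ {n})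
<ₗₑₓ-wellFounded = Lex.<-wellFounded trans (proj₁ (resp₂ ℕ._<_)) <-wellFounded

-- Entries after `i` are left free, because an exchange makes the entry of the larger job `j` grow.
tabulate-<ₗₑₓ : ∀ {n} {f g : Fin n → ℕ} i → (∀ {x} → x Fin.< i → f x ≡ g x) → f i ℕ.< g i →
                tabulate f <ₗₑₓ tabulate g
tabulate-<ₗₑₓ zero    _   fi<gi = this fi<gi refl
tabulate-<ₗₑₓ (suc i) f≡g fi<gi =
  next (f≡g (s≤s z≤n)) (tabulate-<ₗₑₓ i (f≡g ∘ s≤s) fi<gi)

-- Sizes of subsets.

∣p∪q∣≤∣p∣+∣q∣ : ∀ {n} (p q : Subset n) → ∣ p ∪ q ∣ ℕ.≤ ∣ p ∣ ℕ.+ ∣ q ∣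
∣p∪q∣≤∣p∣+∣q∣ []            []            = z≤n
∣p∪q∣≤∣p∣+∣q∣ (outside ∷ p) (outside ∷ q) = ∣p∪q∣≤∣p∣+∣q∣ p q
∣p∪q∣≤∣p∣+∣q∣ (inside  ∷ p) (outside ∷ q) = s≤s (∣p∪q∣≤∣p∣+∣q∣ p q)
∣p∪q∣≤∣p∣+∣q∣ (outside ∷ p) (inside  ∷ q) =
  ℕ.≤-trans (s≤s (∣p∪q∣≤∣p∣+∣q∣ p q)) (ℕ.≤-reflexive (sym (ℕ.+-suc ∣ p ∣ ∣ q ∣)))
∣p∪q∣≤∣p∣+∣q∣ (inside  ∷ p) (inside  ∷ q) = s≤s (ℕ.≤-trans (∣p∪q∣≤∣p∣+∣q∣ p q)
  (ℕ.+-monoʳ-≤ ∣ p ∣ (ℕ.n≤1+n ∣ q ∣)))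

-- At most `i` enters, while `j` certainly leaves since it was in `p`.
∣exchange∣≤ : ∀ {n} {p q : Subset n} {i j} → j ∈ p →
              (∀ {x} → x ∈ q → x ≡ i ⊎ x ∈ p × x ≢ j) → ∣ q ∣ ℕ.≤ ∣ p ∣
∣exchange∣≤ {p = p} {q} {i} {j} j∈p q⊆ = begin
  ∣ q ∣                   ≤⟨ p⊆q⇒∣p∣≤∣q∣ (x∈p∪q⁺ ∘ split ∘ q⊆) ⟩
  ∣ ⁅ i ⁆ ∪ (p - j) ∣     ≤⟨ ∣p∪q∣≤∣p∣+∣q∣ ⁅ i ⁆ (p - j) ⟩
  ∣ ⁅ i ⁆ ∣ ℕ.+ ∣ p - j ∣ ≡⟨ cong (ℕ._+ ∣ p - j ∣) (∣⁅x⁆∣≡1 i) ⟩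
  ℕ.suc ∣ p - j ∣         ≤⟨ x∈p⇒∣p-x∣<∣p∣ j∈p ⟩
  ∣ p ∣                   ∎
  where
  open ℕ.≤-Reasoning
  split : ∀ {x} → x ≡ i ⊎ x ∈ p × x ≢ j → x ∈ ⁅ i ⁆ ⊎ x ∈ p - j
  split (inj₁ refl)        = inj₁ (x∈⁅x⁆ i)
  split (inj₂ (x∈p , x≢j)) = inj₂ (x∈p∧x≢y⇒x∈p-y x∈p x≢j)

-- Finite lists of subsets and of witnesses.

subsets : ∀ n → List (Subset n)
subsets ℕ.zero    = [] ∷ []
subsets (ℕ.suc n) = cartesianProductWith _∷_ (outside ∷ inside ∷ []) (subsets n)

∈-subsets : ∀ {n} (p : Subset n) → p ∈ˡ subsets n
∈-subsets []            = here refl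
∈-subsets (outside ∷ p) = ∈-cartesianProductWith⁺ _∷_ {xs = outside ∷ inside ∷ []}
  (here refl) (∈-subsets p)
∈-subsets (inside  ∷ p) = ∈-cartesianProductWith⁺ _∷_ {xs = outside ∷ inside ∷ []}
  (there (here refl)) (∈-subsets p)

witnesses : ∀ {X : Set} {P : Pred X 0ℓ} → Decidable P → List X → List (∃ P)
witnesses P? []       = []
witnesses P? (x ∷ xs) with P? x
... | yes px = (x , px) ∷ witnesses P? xs
... | no  _  = witnesses P? xs

-- The list stores the proof found by `P?`, which may differ from the given `px`; hence the
-- existential over proofs.
∈-witnesses : ∀ {X : Set} {P : Pred X 0ℓ} (P? : Decidable P) {x xs} → x ∈ˡ xs → P x →
              ∃ λ px → (x , px) ∈ˡ witnesses P? xs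
∈-witnesses P? {x} (here refl) px with P? x
... | yes px′ = px′ , here refl
... | no  ¬px = contradiction px ¬px
∈-witnesses P? {xs = y ∷ _} (there x∈) px with P? y | ∈-witnesses P? x∈ px
... | yes _ | px′ , x∈′ = px′ , there x∈′
... | no  _ | px′ , x∈′ = px′ , x∈′

module _ (I : Instance) where
  open Instance I

  -- Exchanging the units of one inversion pair.

  module Exchange
    (sorted : SortedIndices I)
    {A : Schedule I} (feasible : IsFeasible I A)
    {i j : Fin n} {t t′ : ℤ} (i<j : i Fin.< j) (t<t′ : t ℤ.< t′)
    (j∈At : j ∈ A t) (i∉At : i ∉ A t) (i∈At′ : i ∈ A t′) (j∉At′ : j ∉ A t′)
    where

    open IsFeasible feasible

    -- The exchange is a relabelling of slots, job by job: B processes x in slot s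
    -- exactly when A processes x in slot σ x s.
    σ : Fin n → ℤ → ℤ
    σ x = if does (x Fin.≟ i) ∨ does (x Fin.≟ j) then transpose t t′ else id

    -- Each alternative is an equation between functions, so one match settles `σ x` at all slots
    -- without function extensionality.
    σ-cases : ∀ x → (x ≡ i ⊎ x ≡ j) × σ x ≡ transpose t t′
                  ⊎ (x ≢ i × x ≢ j) × σ x ≡ id
    σ-cases x with x Fin.≟ i | x Fin.≟ j
    ... | yes x≡i | _       = inj₁ (inj₁ x≡i , refl)
    ... | no  _   | yes x≡j = inj₁ (inj₂ x≡j , refl)
    ... | no  x≢i | no  x≢j = inj₂ ((x≢i , x≢j) , refl)

    σ-i : σ i ≡ transpose t t′
    σ-i with σ-cases i
    ... | inj₁ (_ , eq)        = eq
    ... | inj₂ ((i≢i , _) , _) = contradiction refl i≢i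

    σ-j : σ j ≡ transpose t t′
    σ-j with σ-cases j
    ... | inj₁ (_ , eq)        = eq
    ... | inj₂ ((_ , j≢j) , _) = contradiction refl j≢j

    σ-involutive : ∀ x s → σ x (σ x s) ≡ s
    σ-involutive x s with σ x | σ-cases x
    ... | _ | inj₁ (_ , refl) = transpose-involutive t t′ s
    ... | _ | inj₂ (_ , refl) = refl

    σ-fixes : ∀ x {s} → s ≢ t → s ≢ t′ → σ x s ≡ s
    σ-fixes x s≢t s≢t′ with σ x | σ-cases x
    ... | _ | inj₁ (_ , refl) = transpose-other t t′ s≢t s≢t′
    ... | _ | inj₂ (_ , refl) = refl

    B : Schedule I
    B s = tabulate (λ x → lookup (A (σ x s)) x)

    ∈B⇔ : ∀ x s → x ∈ B s ⇔ x ∈ A (σ x s)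
    ∈B⇔ x s = mk⇔
      (λ x∈ → lookup⇒[]= x _ (trans (sym (lookup∘tabulate _ x)) ([]=⇒lookup x∈)))
      (λ x∈ → lookup⇒[]= x _ (trans (lookup∘tabulate _ x) ([]=⇒lookup x∈)))

    i∈Bt : i ∈ B t
    i∈Bt = from (∈B⇔ i t)
      (subst (λ s → i ∈ A s) (sym (trans (cong (λ f → f t) σ-i) (transpose-left t t′))) i∈At′)

    j∈Bt′ : j ∈ B t′
    j∈Bt′ = from (∈B⇔ j t′)
      (subst (λ s → j ∈ A s) (sym (trans (cong (λ f → f t′) σ-j) (transpose-right t t′))) j∈At)

    -- The reasons why a job can sit in a slot of `B`. The side conditions of `kept` record the
    -- departures, `j` from `t` and `i` from `t′`, on which the load bound relies.
    data Origin (x : Fin n) (s : ℤ) : Set where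
      moved-i : x ≡ i → s ≡ t → Origin x s
      moved-j : x ≡ j → s ≡ t′ → Origin x s
      kept    : x ∈ A s → (s ≡ t → x ≢ j) → (s ≡ t′ → x ≢ i) → Origin x s

    origin : ∀ {x s} → x ∈ B s → Origin x s
    origin {x} {s} x∈Bs = helper (σ-cases x) (s ℤ.≟ t) (s ℤ.≟ t′)
      where
      x∈A : ∀ {f u} → σ x ≡ f → f s ≡ u → x ∈ A u
      x∈A refl refl = to (∈B⇔ x s) x∈Bs

      helper : (x ≡ i ⊎ x ≡ j) × σ x ≡ transpose t t′ ⊎ (x ≢ i × x ≢ j) × σ x ≡ id →
               Dec (s ≡ t) → Dec (s ≡ t′) → Origin x s
      helper (inj₁ (inj₁ refl , eq)) (yes s≡t) _          = moved-i refl s≡t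
      -- `B` has `i` at `t′` only if `A` has `i` at `t`, which the inversion pair excludes; the next
      -- clause is the mirror image for `j`.
      helper (inj₁ (inj₁ refl , eq)) (no _)    (yes refl) =
        contradiction (x∈A eq (transpose-right t t′)) i∉At
      helper (inj₁ (inj₂ refl , eq)) (yes refl) _         =
        contradiction (x∈A eq (transpose-left t t′)) j∉At′
      helper (inj₁ (inj₂ refl , eq)) (no _)    (yes s≡t′) = moved-j refl s≡t′
      helper (inj₁ (_ , eq))         (no s≢t)  (no s≢t′)  =
        kept (x∈A eq (transpose-other t t′ s≢t s≢t′))
             (λ s≡t → contradiction s≡t s≢t) (λ s≡t′ → contradiction s≡t′ s≢t′)
      helper (inj₂ ((x≢i , x≢j) , eq)) _ _ = kept (x∈A eq refl) (λ _ → x≢j) (λ _ → x≢i)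

    t≢t′ : t ≢ t′
    t≢t′ = ℤ.<⇒≢ t<t′

    capacity′ : ∀ s → ∣ B s ∣ ℕ.≤ m
    capacity′ s = ℕ.≤-trans (load (s ℤ.≟ t) (s ℤ.≟ t′)) (capacity s)
      where
      at-t : ∀ {x} → Origin x t → x ≡ i ⊎ x ∈ A t × x ≢ j
      at-t (moved-i x≡i _)  = inj₁ x≡i
      at-t (moved-j _ t≡t′) = contradiction t≡t′ t≢t′
      at-t (kept x∈ x≢j _)  = inj₂ (x∈ , x≢j refl)

      at-t′ : ∀ {x} → Origin x t′ → x ≡ j ⊎ x ∈ A t′ × x ≢ i
      at-t′ (moved-i _ t′≡t) = contradiction (sym t′≡t) t≢t′
      at-t′ (moved-j x≡j _)  = inj₁ x≡j
      at-t′ (kept x∈ _ x≢i)  = inj₂ (x∈ , x≢i refl)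

      load : Dec (s ≡ t) → Dec (s ≡ t′) → ∣ B s ∣ ℕ.≤ ∣ A s ∣
      load (yes refl) _          = ∣exchange∣≤ j∈At (at-t ∘ origin)
      load (no _)     (yes refl) = ∣exchange∣≤ i∈At′ (at-t′ ∘ origin)
      load (no s≢t)   (no s≢t′)  = p⊆q⇒∣p∣≤∣q∣
        (λ {x} x∈ → subst (λ u → x ∈ A u) (σ-fixes x s≢t s≢t′) (to (∈B⇔ x s) x∈))

    -- The order of release times enters here. The bound keeps `i` in its window and later makes the
    -- decrease of its offset strict.
    ri≤t : r i ℤ.≤ t
    ri≤t = ℤ.≤-trans (proj₁ (sorted i j i<j)) (proj₁ (within-window j t j∈At))

    within-window′ : ∀ x s → x ∈ B s → Window x s
    within-window′ x s x∈ with origin x∈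
    ... | moved-i refl refl =
      ri≤t , ℤ.≤-trans (ℤ.<⇒≤ t<t′) (proj₂ (within-window i t′ i∈At′))
    -- The order of deadlines enters here: `t′` is at most `d i`, hence at most `d j`.
    ... | moved-j refl refl =
      ℤ.≤-trans (proj₁ (within-window j t j∈At)) (ℤ.<⇒≤ t<t′) ,
      ℤ.≤-trans (proj₂ (within-window i t′ i∈At′)) (proj₂ (sorted i j i<j))
    ... | kept x∈As _ _     = within-window x s x∈As

    -- At the two exchanged slots the given job may be the one that leaves, so a job of the pair
    -- that is certain to be there serves as witness instead.
    active⇔ : ∀ s → Active I A s ⇔ Active I B s
    active⇔ s = mk⇔ (λ (x , x∈) → forth x x∈ (s ℤ.≟ t) (s ℤ.≟ t′)) (λ (x , x∈) → back (origin x∈))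
      where
      forth : ∀ x → x ∈ A s → Dec (s ≡ t) → Dec (s ≡ t′) → Active I B s
      forth x x∈ (yes refl) _          = i , i∈Bt
      forth x x∈ (no _)     (yes refl) = j , j∈Bt′
      forth x x∈ (no s≢t)   (no s≢t′)  =
        x , from (∈B⇔ x s) (subst (λ u → x ∈ A u) (sym (σ-fixes x s≢t s≢t′)) x∈)

      back : ∀ {x} → Origin x s → Active I A s
      back (moved-i _ refl) = j , j∈At
      back (moved-j _ refl) = i , i∈At′
      back (kept x∈ _ _)    = _ , x∈

    processed⇔ : ∀ x → Processed I A x ⇔ Processed I B x
    processed⇔ x = mk⇔
      (λ (s , x∈) → σ x s ,
        from (∈B⇔ x (σ x s)) (subst (λ u → x ∈ A u) (sym (σ-involutive x s)) x∈))
      (λ (s , x∈) → σ x s , to (∈B⇔ x s) x∈)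

    -- The slots of `x` in `B` are the preimage of its slots in `A` under the involution `σ x`, so
    -- both sets have the same size.
    completed⇔ : ∀ x → Completed I A x ⇔ Completed I B x
    completed⇔ x = mk⇔
      (hasSize-cong (λ s → ⇔.sym (∈B⇔ x s)) ∘ hasSize-∘ (σ-involutive x))
      (hasSize-∘⁻ (σ-involutive x) ∘ hasSize-cong (∈B⇔ x))

    feasible′ : IsFeasible I B
    feasible′ = record
      { capacity            = capacity′
      ; within-window       = within-window′
      ; budget              = let k , k≤K , size = budget in k , k≤K , hasSize-cong active⇔ size
      ; processed⇔completed = λ x →
          ⇔.trans (⇔.sym (processed⇔ x)) (⇔.trans (processed⇔completed x) (completed⇔ x))
      }

  -- The termination measure and its decrease.

  column : List ℤ → Schedule I → Fin n → List ℤ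
  column ts A x = filter (λ s → x ∈? A s) ts

  offsets : List ℤ → Schedule I → Fin n → ℕ
  offsets ts A x = sum (map (λ s → ℤ.∣ s ℤ.- r x ∣) (column ts A x))

  module _ (sorted : SortedIndices I) {A} (feasible : IsFeasible I A)
    {ts} (enum : Enumerates ts (Active I A))
    {i j t t′} (i<j : i Fin.< j) (t<t′ : t ℤ.< t′)
    (j∈At : j ∈ A t) (i∉At : i ∉ A t) (i∈At′ : i ∈ A t′) (j∉At′ : j ∉ A t′)
    where

    open Exchange sorted feasible i<j t<t′ j∈At i∉At i∈At′ j∉At′

    exchange-decreases : tabulate (offsets ts B) <ₗₑₓ tabulate (offsets ts A)
    exchange-decreases = tabulate-<ₗₑₓ i unchanged (begin-strict
      -- Filtering `ts` and relabelling the old column list the same slots in possibly different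
      -- orders, so the sums are compared through a permutation.
      sum (map h (column ts B i))         ≡⟨ sum-↭ (↭.map⁺ h column-i) ⟩
      sum (map h (map τ (column ts A i))) ≡⟨ cong sum (map-∘ (column ts A i)) ⟨
      sum (map (h ∘ τ) (column ts A i))   <⟨ sum-mono-< earlier t′∈column-i strictly-earlier ⟩
      sum (map h (column ts A i))         ∎)
      where
      open ℕ.≤-Reasoning

      h : ℤ → ℕ
      h s = ℤ.∣ s ℤ.- r i ∣

      τ : ℤ → ℤ
      τ = transpose t t′

      unchanged : ∀ {x} → x Fin.< i → offsets ts B x ≡ offsets ts A x
      unchanged {x} x<i with σ x | σ-cases x | ∈B⇔ x
      -- A job below `i` is neither `i` nor `j`, so its relabelling is the identity.
      ... | _ | inj₁ (inj₁ refl , _) | _ = contradiction x<i (Fin.<-irrefl refl)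
      ... | _ | inj₁ (inj₂ refl , _) | _ = contradiction x<i (Fin.<-asym i<j)
      ... | _ | inj₂ (_ , refl)      | x∈B⇔ = cong (sum ∘ map _)
        (filter-≐ (λ s → x ∈? B s) (λ s → x ∈? A s)
          ((λ {s} → to (x∈B⇔ s)) , (λ {s} → from (x∈B⇔ s))) ts)

      enum-i : Enumerates (column ts A i) (λ s → i ∈ A s)
      enum-i = enumerates-filter (λ s → i ∈? A s) (proj₁ enum)
        (λ {s} i∈ → to (proj₂ enum s) (i , i∈))

      t′∈column-i : t′ ∈ˡ column ts A i
      t′∈column-i = to (proj₂ enum-i t′) i∈At′

      column-i : column ts B i ↭ map τ (column ts A i)
      column-i = enumerates-↭
        (enumerates-filter (λ s → i ∈? B s) (proj₁ enum)
          (λ {s} i∈ → to (proj₂ enum s) (from (active⇔ s) (i , i∈))))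
        (enumerates-cong (λ s → subst (λ f → i ∈ A (f s) ⇔ i ∈ B s) σ-i (⇔.sym (∈B⇔ i s)))
          (enumerates-∘ (transpose-involutive t t′) enum-i))

      strictly-earlier : h (τ t′) ℕ.< h t′
      strictly-earlier =
        subst (λ s → h s ℕ.< h t′) (sym (transpose-right t t′)) (∣offset∣-mono-< ri≤t t<t′)

      earlier : ∀ {s} → s ∈ˡ column ts A i → h (τ s) ℕ.≤ h s
      earlier {s} s∈ = helper (s ℤ.≟ t) (s ℤ.≟ t′)
        where
        helper : Dec (s ≡ t) → Dec (s ≡ t′) → h (τ s) ℕ.≤ h s
        -- Only `t` would be moved to a later slot, and it is absent from the column because `i`
        -- does not run there.
        helper (yes refl) _          = contradiction (from (proj₂ enum-i t) s∈) i∉At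
        helper (no _)     (yes refl) = ℕ.<⇒≤ strictly-earlier
        helper (no s≢t)   (no s≢t′)  = ℕ.≤-reflexive (cong h (transpose-other t t′ s≢t s≢t′))

  -- Repeated exchange.

  inversion? : ∀ {A ts} → (∀ t → Active I A t ⇔ t ∈ˡ ts) → Dec (∃₂ (InversionPair I A))
  inversion? {A} active⇔ = Fin.any? λ i → Fin.any? λ j → (i Fin.<? j) ×-dec
    -- Both slots of an inversion pair are active, since `j` runs in the first and `i` in the
    -- second; searching `ts` is exhaustive.
    ∃? (λ t → ∃? (λ t′ → (t ℤ.<? t′) ×-dec (j ∈? A t) ×-dec (¬? (i ∈? A t)) ×-dec
                         (i ∈? A t′) ×-dec (¬? (j ∈? A t′)))
                 (λ {t′} (_ , _ , _ , i∈ , _) → to (active⇔ t′) (i , i∈)))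
       (λ {t} (_ , _ , j∈ , _) → to (active⇔ t) (j , j∈))

  Straightening : Schedule I → Set
  Straightening A = ∃ λ B → IsFeasible I B × Active I B ⊆ Active I A
    × (∀ j → Completed I A j ⇔ Completed I B j) × NoInversionPairs I B

  -- An exchange preserves the active set, so the same `ts` serves throughout and all measures are
  -- vectors over one list of slots.
  straighten-acc : SortedIndices I → ∀ {A ts} → IsFeasible I A → Enumerates ts (Active I A) →
                   Acc _<ₗₑₓ_ (tabulate (offsets ts A)) → Straightening A
  straighten-acc sorted {A} {ts} feasible enum (acc rec) with inversion? (proj₂ enum)
  ... | no  none = A , feasible , id , (λ _ → ⇔.refl) , λ i j inv → none (i , j , inv)
  ... | yes (i , j , i<j , t , t′ , t<t′ , j∈ , i∉ , i∈ , j∉) =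
    let C , feasibleC , C⊆B , B⇔C , none = straighten-acc sorted {ts = ts} feasible′
          (enumerates-cong active⇔ enum)
          (rec (exchange-decreases sorted feasible enum i<j t<t′ j∈ i∉ i∈ j∉))
    in C , feasibleC , (λ {s} → from (active⇔ s) ∘ C⊆B) ,
       (λ x → ⇔.trans (completed⇔ x) (B⇔C x)) , none
    where open Exchange sorted feasible i<j t<t′ j∈ i∉ i∈ j∉

  straighten : SortedIndices I → ∀ A → IsFeasible I A → Straightening A
  straighten sorted A feasible with IsFeasible.budget feasible
  ... | _ , _ , ts , uniq , _ , active⇔ =
    straighten-acc sorted feasible (uniq , active⇔) (<ₗₑₓ-wellFounded _)

  -- Invariance of weight and decidability of feasibility.

  completedWeight-cong : ∀ {A B} (feasibleA : IsFeasible I A) (feasibleB : IsFeasible I B) →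
    (∀ j → Completed I A j ⇔ Completed I B j) →
    completedWeight I feasibleA ≡ completedWeight I feasibleB
  completedWeight-cong feasibleA feasibleB A⇔B = sum-cong-≗ λ j →
    -- The two decisions come from different feasibility proofs, but only their truth values enter
    -- the weight.
    cong (if_then w j else _)
      (does-⇔ (A⇔B j) (completed? I feasibleA j) (completed? I feasibleB j))

  -- Schedules are functions, so pointwise agreement does not yield an equation to rewrite with;
  -- each property is transported slot by slot.
  completed-≗ : ∀ {A B} → A ≗ B → ∀ j → Completed I A j ⇔ Completed I B j
  completed-≗ A≗B j = mk⇔
    (hasSize-cong (λ t → mk⇔ (subst (j ∈_) (A≗B t)) (subst (j ∈_) (sym (A≗B t)))))
    (hasSize-cong (λ t → mk⇔ (subst (j ∈_) (sym (A≗B t))) (subst (j ∈_) (A≗B t))))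

  isFeasible-≗ : ∀ {A B} → A ≗ B → IsFeasible I A → IsFeasible I B
  isFeasible-≗ A≗B feasible = record
    { capacity            = λ t → subst (λ p → ∣ p ∣ ℕ.≤ m) (A≗B t) (capacity t)
    ; within-window       = λ j t → within-window j t ∘ subst (j ∈_) (sym (A≗B t))
    ; budget              = let k , k≤K , size = budget in k , k≤K , hasSize-cong
        (λ t → mk⇔ (subst Nonempty (A≗B t)) (subst Nonempty (sym (A≗B t)))) size
    ; processed⇔completed = λ j → ⇔.trans
        (mk⇔ (λ (t , j∈) → t , subst (j ∈_) (sym (A≗B t)) j∈)
             (λ (t , j∈) → t , subst (j ∈_) (A≗B t) j∈))
        (⇔.trans (processed⇔completed j) (completed-≗ A≗B j))
    }
    where open IsFeasible feasible

  -- Conditions on all slots are decided by searching for a violation. A violating slot processes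
  -- some job, so it is active and lies in `ts`.
  isFeasible? : ∀ {ts A} → Unique ts → (∀ {t} → Active I A t → t ∈ˡ ts) → Dec (IsFeasible I A)
  isFeasible? {ts} {A} uniq A⊆ts = map′
    (λ (cap , win , bud , p⇔c) → record
      { capacity            = λ t → ℕ.≮⇒≥ λ m<∣At∣ → cap (t , m<∣At∣)
      ; within-window       = λ j t j∈ → decidable-stable (window? j t) λ ¬win →
          win j (t , j∈ , ¬win)
      ; budget              = _ , bud , size
      ; processed⇔completed = λ j → mk⇔ (proj₁ (p⇔c j)) (proj₂ (p⇔c j))
      })
    (λ feasible → let open IsFeasible feasible in
      (λ (t , m<∣At∣) → ℕ.<⇒≱ m<∣At∣ (capacity t)) ,
      (λ j (t , j∈ , ¬win) → ¬win (within-window j t j∈)) ,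
      (let k , k≤K , size′ = budget in subst (ℕ._≤ K) (hasSize-unique size′ size) k≤K) ,
      (λ j → to (processed⇔completed j) , from (processed⇔completed j)))
    (¬? (∃? (λ t → m ℕ.<? ∣ A t ∣) (λ {t} → A⊆ts ∘ nonempty t))
     ×-dec Fin.all? (λ j → ¬? (∃? (λ t → (j ∈? A t) ×-dec ¬? (window? j t))
                                  (λ (j∈ , _) → A⊆ts (j , j∈))))
     ×-dec (_ ℕ.≤? K)
     ×-dec Fin.all? (λ j → (processed? j →-dec completed?′ j) ×-dec
                           (completed?′ j →-dec processed? j)))
    where
    window? : ∀ j t → Dec (Window j t)
    window? j t = (r j ℤ.≤? t) ×-dec (t ℤ.≤? d j)

    -- By uniqueness of sizes, this length is the only candidate for the number of active slots in
    -- the budget.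
    size : HasSize (Active I A) _
    size = hasSize (enumerates-filter (λ t → nonempty? (A t)) uniq A⊆ts)

    processed? : ∀ j → Dec (Processed I A j)
    processed? j = ∃? (λ t → j ∈? A t) (λ j∈ → A⊆ts (j , j∈))

    completed?′ : ∀ j → Dec (Completed I A j)
    completed?′ j = hasSize? (λ t → j ∈? A t) uniq (λ j∈ → A⊆ts (j , j∈)) (p j)

    nonempty : ∀ t → m ℕ.< ∣ A t ∣ → Nonempty (A t)
    nonempty t m<∣At∣ = decidable-stable (nonempty? (A t)) λ empty →
      ℕ.<⇒≱ m<∣At∣ (subst (ℕ._≤ m)
        (sym (trans (cong ∣_∣ (Empty-unique empty)) (∣⊥∣≡0 n))) z≤n)

  -- A finite search space of schedules.

  idle-feasible : IsFeasible I (λ _ → ⊥)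
  idle-feasible = record
    { capacity            = λ _ → subst (ℕ._≤ m) (sym (∣⊥∣≡0 n)) z≤n
    ; within-window       = λ _ _ j∈ → contradiction j∈ ∉⊥
    ; budget              = 0 , z≤n , [] , [] , refl ,
        λ _ → mk⇔ (λ (_ , j∈) → contradiction j∈ ∉⊥) λ ()
    ; processed⇔completed = λ j → mk⇔
        (λ (_ , j∈) → contradiction j∈ ∉⊥)
        -- A job completed without any slot would have `p j` equal to 0, against `p>0`.
        (λ size → contradiction (p>0 j) (ℕ.≤⇒≯ (ℕ.≤-reflexive (hasSize-unique size
          ([] , [] , refl , λ _ → mk⇔ (λ j∈ → contradiction j∈ ∉⊥) λ ())))))
    }

  slots : List ℤ
  slots = deduplicate ℤ._≟_ (concatMap
    (λ j → map (λ k → r j ℤ.+ ℤ.+ k) (upTo (ℕ.suc ℤ.∣ d j ℤ.- r j ∣))) (allFin n))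

  window⊆slots : ∀ {j t} → Window j t → t ∈ˡ slots
  window⊆slots {j} {t} (r≤t , t≤d) =
    ∈-deduplicate⁺ ℤ._≟_ (∈-concatMap⁺ _ (lose (∈-allFin j)
      (subst (_∈ˡ _) (trans (cong (λ i → r j ℤ.+ i) (∣offset∣ r≤t)) r+[t-r]≡t)
        (∈-map⁺ _ (∈-upTo⁺ (s≤s (∣offset∣-mono-≤ r≤t t≤d)))))))
    where
    r+[t-r]≡t : r j ℤ.+ (t ℤ.- r j) ≡ t
    r+[t-r]≡t = trans (ℤ.+-comm (r j) _) (trans (ℤ.+-assoc t _ (r j))
      (trans (cong (λ i → t ℤ.+ i) (ℤ.+-inverseˡ (r j))) (ℤ.+-identityʳ t)))

  -- Emptying the slots outside `ts` confines the activity of an arbitrary schedule to `ts`, which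
  -- puts it within reach of `isFeasible?`.
  restrict : List ℤ → Schedule I → Schedule I
  restrict ts A s = if does (any? (s ℤ.≟_) ts) then A s else ⊥

  restrict-active : ∀ ts A {s} → Active I (restrict ts A) s → s ∈ˡ ts
  restrict-active ts A {s} active with any? (s ℤ.≟_) ts
  ... | yes s∈ = s∈
  ... | no  _  = contradiction (proj₂ active) ∉⊥

  restrict-≗ : ∀ {ts A B} → (∀ {t} → Active I A t → t ∈ˡ ts) → (∀ {t} → t ∈ˡ ts → A t ≡ B t) →
               A ≗ restrict ts B
  restrict-≗ {ts} {A} A⊆ts A≡B s with any? (s ℤ.≟_) ts
  ... | yes s∈ = A≡B s∈
  ... | no  s∉ = Empty-unique (s∉ ∘ A⊆ts)

  update : ℤ → Subset n → Schedule I → Schedule I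
  update t p A s = if does (s ℤ.≟ t) then p else A s

  schedules : List ℤ → List (Schedule I)
  schedules []       = (λ _ → ⊥) ∷ []
  schedules (t ∷ ts) = cartesianProductWith (update t) (subsets n) (schedules ts)

  -- Agreement on `ts` suffices, since `restrict` takes care of the remaining slots.
  schedules-complete : ∀ ts (A : Schedule I) →
                       ∃ λ B → B ∈ˡ schedules ts × (∀ {t} → t ∈ˡ ts → A t ≡ B t)
  schedules-complete []       A = _ , here refl , λ ()
  schedules-complete (t ∷ ts) A with schedules-complete ts A
  ... | B , B∈ , A≡B =
    update t (A t) B , ∈-cartesianProductWith⁺ (update t) (∈-subsets (A t)) B∈ , agree
    where
    agree : ∀ {s} → s ∈ˡ t ∷ ts → A s ≡ update t (A t) B s
    agree {s} s∈ with s ℤ.≟ t | s∈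
    ... | yes refl | _         = refl
    ... | no  s≢t  | here s≡t  = contradiction s≡t s≢t
    ... | no  _    | there s∈′ = A≡B s∈′

  -- Existence of an optimal schedule and its straightening.

  optimal-schedule : ∃ λ A → Σ (IsFeasible I A) (IsOptimal I)
  optimal-schedule = restrict slots (proj₁ best) , proj₂ best , optimal
    where
    Candidate : Set
    Candidate = ∃ λ A → IsFeasible I (restrict slots A)

    candidate? : ∀ A → Dec (IsFeasible I (restrict slots A))
    candidate? A = isFeasible? (deduplicate-! ℤ._≟_ _) (restrict-active slots A)

    candidates : List Candidate
    candidates = witnesses candidate? (schedules slots)

    weight : Candidate → _
    weight (_ , feasible) = completedWeight I feasible

    -- The default value that `argmax` requires alongside the list of candidates.
    idle : Candidate
    idle = (λ _ → ⊥) , isFeasible-≗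
      (restrict-≗ {slots} (λ (_ , j∈) → contradiction j∈ ∉⊥) (λ _ → refl)) idle-feasible

    best : Candidate
    best = argmax weight idle candidates

    optimal : IsOptimal I (proj₂ best)
    optimal {B} feasibleB =
      -- A feasible schedule is active only inside windows, so it agrees pointwise with a restricted
      -- listed schedule, whose weight the maximum bounds.
      let C , C∈ , B≡C = schedules-complete slots B
          B≗C : B ≗ restrict slots C
          B≗C = restrict-≗
            (λ {t} (j , j∈) → window⊆slots (IsFeasible.within-window feasibleB j t j∈)) B≡C
          feasibleC , C∈candidates = ∈-witnesses candidate? C∈ (isFeasible-≗ B≗C feasibleB)
      in ℚ.≤-trans
           (ℚ.≤-reflexive (completedWeight-cong feasibleB feasibleC (completed-≗ B≗C)))
           (All.lookup (f[xs]≤f[argmax] {f = weight} idle candidates) C∈candidates)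

  -- Straightening keeps the set of completed jobs, hence the weight, hence optimality.
  straighten-optimal : SortedIndices I → (∃ λ A → Σ (IsFeasible I A) (IsOptimal I)) →
    ∃ λ B → Σ (IsFeasible I B) λ feasible → IsOptimal I feasible × NoInversionPairs I B
  straighten-optimal sorted (A , feasibleA , optimalA) =
    let B , feasibleB , _ , A⇔B , none = straighten sorted A feasibleA
    in B , feasibleB ,
       (λ feasibleC → ℚ.≤-trans (optimalA feasibleC)
         (ℚ.≤-reflexive (completedWeight-cong feasibleA feasibleB A⇔B))) ,
       none

lemma5 : (I : Instance) → ProperIntervals I → SortedIndices I →
    (∀ A → IsFeasible I A →
    ∃ λ B → IsFeasible I B
    × Active I B ⊆ Active I A
    × (∀ j → Completed I A j ⇔ Completed I B j)
    × NoInversionPairs I B)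
    × (∃ λ A → Σ (IsFeasible I A) λ feasible →
    IsOptimal I feasible × NoInversionPairs I A)
lemma5 I _ sorted = straighten I sorted , straighten-optimal I sorted (optimal-schedule I)
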